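{- Let $G'$ and $H'$ be two non-trivial, connected graphs. Then $$r(G' \boxtimes H') \le rc(G' \boxtimes H') \le 2\,r(G' \boxtimes H') + 2.$$
   Context: All graphs are finite, simple and undirected. A graph is trivial if it has order (number of vertices) 0 or 1, and non-trivial otherwise. For a connected graph $G$: $dist_G(u,v)$ is the length (number of edges) of a shortest path between $u$ and $v$; the eccentricity of a vertex $v$ is $ecc(v)=\max\{dist_G(v,u): u\in V(G)\}$; the radius is $r(G)=\min\{ecc(v): v\in V(G)\}$. An edge coloring of $G$ is any function from $E(G)$ to a set of colors (not necessarily proper). A path is a rainbow path if no two of its edges have the same color. An edge coloring is a rainbow coloring if every pair of vertices is connected by at least one rainbow path. The rainbow connection number $rc(G)$ of a connected graph $G$ is the minimum number of colors in a rainbow coloring of $G$. The strong product $G \boxtimes H$ has vertex set $V(G)\times V(H)$; two distinct vertices $[g_1,h_1]$ and $[g_2,h_2]$ are adjacent if and only if one of the following holds: (1) $g_1=g_2$ and $(h_1,h_2)\in E(H)$; (2) $h_1=h_2$ and $(g_1,g_2)\in E(G)$; (3) $(g_1,g_2)\in E(G)$ and $(h_1,h_2)\in E(H)$. -}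

module Defs where

open import Data.Empty using (⊥-elim)
open import Data.Fin using (Fin; zero; suc; toℕ; fromℕ<; combine; remQuot)
import Data.Fin.Properties as Fin
open import Data.List as List using (List; []; _∷_; allFin)
open import Data.List.Extrema.Nat
  using (argmin; argmax; f[argmin]≤f[xs]; f[xs]≤f[argmax])
open import Data.List.Membership.Propositional using (_∈_)
open import Data.List.Membership.Propositional.Properties using (∈-allFin; ∈-map⁺; ∈-lookup)
open import Data.List.Relation.Unary.All as All using (All; []; _∷_)
open import Data.List.Relation.Unary.All.Properties using (¬Any⇒All¬)
open import Data.List.Relation.Unary.Any using (here; there)
import Data.List.Relation.Unary.Any as Any
open import Data.List.Relation.Unary.AllPairs using ([]; _∷_; allPairs?)
open import Data.List.Relation.Unary.Unique.Propositional using (Unique)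
open import Data.Nat using (ℕ; zero; suc; _*_; _≤_; z≤n; s≤s; _≤?_)
import Data.Nat.Properties as ℕ
open import Data.Product using (∃; _×_; _,_; proj₁; proj₂; uncurry)
open import Data.Product.Function.NonDependent.Propositional using (_×-↔_)
open import Data.Sum using (_⊎_; inj₁; inj₂)
open import Data.Vec as Vec using (Vec; []; _∷_)
open import Data.Vec.Properties using (lookup∘tabulate)
open import Function using (_∘_; _↔_; Inverse; Injective)
open import Function.Construct.Composition using (_↔-∘_)
open import Function.Construct.Symmetry using (↔-sym)
open import Relation.Binary.Core using (Rel)
open import Relation.Binary.Definitions using (Symmetric; DecidableEquality)
  renaming (Decidable to Decidable₂; Irrelevant to Irrelevant₂)
open import Relation.Binary.PropositionalEquality
open import Relation.Nullary using (¬_; ¬?; Dec; yes; no; contradiction)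
open import Relation.Nullary.Decidable using (map′; _×-dec_; _⊎-dec_)
open import Relation.Unary using (Decidable)
open import Level using (0ℓ)

record Graph : Set₁ where
  field
    Vertex         : Set
    order          : ℕ
    enumeration    : Vertex ↔ Fin order
    Adj            : Rel Vertex 0ℓ
    adj?           : Decidable₂ Adj
    adj-sym        : Symmetric Adj
    adj-irrefl     : ∀ {v} → ¬ Adj v v
    -- No parallel edges.
    adj-irrelevant : Irrelevant₂ Adj

  index : Vertex → Fin order
  index = Inverse.to enumeration

  vertex : Fin order → Vertex
  vertex = Inverse.from enumeration

  vertex-index : ∀ v → vertex (index v) ≡ v
  vertex-index = Inverse.strictlyInverseʳ enumeration

  index-injective : Injective _≡_ _≡_ index
  index-injective {u} {v} eq =
    trans (sym (vertex-index u)) (trans (cong vertex eq) (vertex-index v))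

  infix 4 _≟_
  _≟_ : DecidableEquality Vertex
  u ≟ v = map′ index-injective (cong index) (index u Fin.≟ index v)

  allVertices : List Vertex
  allVertices = List.map vertex (allFin order)

  ∈-allVertices : ∀ v → v ∈ allVertices
  ∈-allVertices v =
    subst (_∈ allVertices) (vertex-index v) (∈-map⁺ vertex (∈-allFin (index v)))

  anyVertex? : {P : Vertex → Set} → Decidable P → Dec (∃ P)
  anyVertex? {P} P? =
    map′ (λ (i , p) → vertex i , p)
         (λ (v , p) → index v , subst P (sym (vertex-index v)) p)
         (Fin.any? (P? ∘ vertex))

  allVertices? : {P : Vertex → Set} → Decidable P → Dec (∀ v → P v)
  allVertices? {P} P? =
    map′ (λ p v → subst P (vertex-index v) (p (index v)))
         (λ p i → p (vertex i))
         (Fin.all? (P? ∘ vertex))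

NonTrivial : Graph → Set
NonTrivial G = 2 ≤ Graph.order G

IsMinimum : (ℕ → Set) → ℕ → Set
IsMinimum P m = P m × (∀ n → P n → m ≤ n)

IsMaximum : (ℕ → Set) → ℕ → Set
IsMaximum P m = P m × (∀ n → P n → n ≤ m)

minimum-unique : ∀ {P m n} → IsMinimum P m → IsMinimum P n → m ≡ n
minimum-unique (pm , m≤) (pn , n≤) = ℕ.≤-antisym (m≤ _ pn) (n≤ _ pm)

maximum-unique : ∀ {P m n} → IsMaximum P m → IsMaximum P n → m ≡ n
maximum-unique (pm , ≤m) (pn , ≤n) = ℕ.≤-antisym (≤n _ pm) (≤m _ pn)

minimum : ∀ {P : ℕ → Set} → Decidable P → ∃ P → ∃ (IsMinimum P)
minimum {P} P? (n , pn) = search n P? pn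
  where
  search : ∀ n {Q : ℕ → Set} → Decidable Q → Q n → ∃ (IsMinimum Q)
  search zero    Q? q = zero , q , λ _ _ → z≤n
  search (suc n) Q? q with Q? zero
  ... | yes q₀ = zero , q₀ , λ _ _ → z≤n
  ... | no ¬q₀ with search n (Q? ∘ suc) q
  ...   | m , qm , m≤ = suc m , qm , λ where
            zero    q₀ → contradiction q₀ ¬q₀
            (suc k) qk → s≤s (m≤ k qk)

module _ (G : Graph) where
  open Graph G

  data Walk : Vertex → Vertex → Set where
    []  : ∀ {v} → Walk v v
    _∷_ : ∀ {u w v} → Adj u w → Walk w v → Walk u v

module _ {G : Graph} where
  open Graph G

  length : ∀ {u v} → Walk G u v → ℕ
  length []      = 0
  length (e ∷ w) = suc (length w)

  vertices : ∀ {u v} → Walk G u v → List Vertex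
  vertices {u} []      = u ∷ []
  vertices {u} (e ∷ w) = u ∷ vertices w

  IsPath : ∀ {u v} → Walk G u v → Set
  IsPath w = Unique (vertices w)

module _ (G : Graph) where
  open Graph G

  Connected : Set
  Connected = ∀ u v → ∃ λ (w : Walk G u v) → IsPath w

  IsDistance : Vertex → Vertex → ℕ → Set
  IsDistance u v = IsMinimum λ n → ∃ λ (w : Walk G u v) → length w ≡ n × IsPath w

  IsEccentricity : Vertex → ℕ → Set
  IsEccentricity v = IsMaximum λ d → ∃ λ u → IsDistance v u d

  IsRadius : ℕ → Set
  IsRadius = IsMinimum λ e → ∃ λ v → IsEccentricity v e

-- An edge colouring with palette Fin k.  A colour of the palette need not
-- occur; this does not affect the least k admitting a rainbow colouring.
record Colouring (G : Graph) (k : ℕ) : Set where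
  open Graph G
  field
    colour     : ∀ {u v} → Adj u v → Fin k
    colour-sym : ∀ {u v} (e : Adj u v) → colour (adj-sym e) ≡ colour e

open Colouring

module _ {G : Graph} {k : ℕ} where
  open Graph G

  colours : ∀ {u v} → Colouring G k → Walk G u v → List (Fin k)
  colours c []      = []
  colours c (e ∷ w) = colour c e ∷ colours c w

  IsRainbowPath : ∀ {u v} → Colouring G k → Walk G u v → Set
  IsRainbowPath c w = IsPath w × Unique (colours c w)

  IsRainbow : Colouring G k → Set
  IsRainbow c = ∀ u v → ∃ λ (w : Walk G u v) → IsRainbowPath c w

IsRainbowConnectionNumber : Graph → ℕ → Set
IsRainbowConnectionNumber G = IsMinimum λ k → ∃ λ (c : Colouring G k) → IsRainbow c

unique? : ∀ {A : Set} → DecidableEquality A → Decidable (Unique {A = A})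
unique? _≟_ = allPairs? (λ x y → ¬? (x ≟ y))

lookup-injective : ∀ {A : Set} {xs : List A} → Unique xs →
                   Injective _≡_ _≡_ (List.lookup xs)
lookup-injective (x∉ ∷ _) {zero}  {zero}  _  = refl
lookup-injective (x∉ ∷ _) {zero}  {suc j} eq = ⊥-elim (All.lookup x∉ (∈-lookup j) eq)
lookup-injective (x∉ ∷ _) {suc i} {zero}  eq = ⊥-elim (All.lookup x∉ (∈-lookup i) (sym eq))
lookup-injective (_ ∷ u)  {suc i} {suc j} eq = cong suc (lookup-injective u eq)

unique⇒length≤ : ∀ {k} {xs : List (Fin k)} → Unique xs → List.length xs ≤ k
unique⇒length≤ u = Fin.injective⇒≤ (lookup-injective u)

module _ (G : Graph) where
  open Graph G

  walkOfLength? : ∀ n {u v} {P : Walk G u v → Set} → Decidable P →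
                  Dec (∃ λ w → length w ≡ n × P w)
  walkOfLength? zero {u} {v} P? with u ≟ v
  ... | no u≢v   = no λ { ([] , _) → u≢v refl }
  ... | yes refl = map′ (λ p → [] , refl , p) (λ { ([] , _ , p) → p }) (P? [])
  walkOfLength? (suc n) {u} {v} {P} P? =
    map′ (λ { (_ , e , w , eq , p) → e ∷ w , cong suc eq , p })
         (λ { (e ∷ w , eq , p) → _ , e , w , ℕ.suc-injective eq , p })
         (anyVertex? step)
    where
    step : ∀ x → Dec (∃ λ (e : Adj u x) → ∃ λ (w : Walk G x v) → length w ≡ n × P (e ∷ w))
    step x with adj? u x
    ... | no ¬e = no (¬e ∘ proj₁)
    ... | yes e = map′ (e ,_) back (walkOfLength? n (P? ∘ (e ∷_)))
      where
      back : (∃ λ e′ → ∃ λ (w : Walk G x v) → length w ≡ n × P (e′ ∷ w)) →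
             ∃ λ (w : Walk G x v) → length w ≡ n × P (e ∷ w)
      back (e′ , w) rewrite adj-irrelevant e′ e = w

  isPath? : ∀ {u v} → Decidable (IsPath {G} {u} {v})
  isPath? w = unique? _≟_ (vertices w)

  module _ (conn : Connected G) where

    distance : ∀ u v → ∃ (IsDistance G u v)
    distance u v =
      minimum (λ n → walkOfLength? n isPath?)
              (let w , p = conn u v in length w , w , refl , p)

    eccentricity : ∀ v → ∃ (IsEccentricity G v)
    eccentricity v = d far , (far , proj₂ (distance v far)) , bound
      where
      d : Vertex → ℕ
      d u = proj₁ (distance v u)

      far : Vertex
      far = argmax d v allVertices

      bound : ∀ n → (∃ λ u → IsDistance G v u n) → n ≤ d far
      bound n (u , isD) =
        subst (_≤ d far) (minimum-unique (proj₂ (distance v u)) isD)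
              (All.lookup (f[xs]≤f[argmax] v allVertices) (∈-allVertices u))

    radius-exists : NonTrivial G → ∃ (IsRadius G)
    radius-exists nt = e centre , (centre , proj₂ (eccentricity centre)) , bound
      where
      e : Vertex → ℕ
      e v = proj₁ (eccentricity v)

      v₀ : Vertex
      v₀ = vertex (fromℕ< (ℕ.<⇒≤ nt))

      centre : Vertex
      centre = argmin e v₀ allVertices

      bound : ∀ n → (∃ λ v → IsEccentricity G v n) → e centre ≤ n
      bound n (v , isE) =
        subst (e centre ≤_) (maximum-unique (proj₂ (eccentricity v)) isE)
              (All.lookup (f[argmin]≤f[xs] v₀ allVertices) (∈-allVertices v))

anyVec? : ∀ {k} n {P : Vec (Fin k) n → Set} → Decidable P → Dec (∃ P)
anyVec? zero    P? = map′ ([] ,_) (λ { ([] , p) → p }) (P? [])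
anyVec? (suc n) P? =
  map′ (λ { (x , xs , p) → x ∷ xs , p }) (λ { (x ∷ xs , p) → x , xs , p })
       (Fin.any? λ x → anyVec? n (P? ∘ (x ∷_)))

module _ (G : Graph) where
  open Graph G

  -- A code for the unordered pair {u , v}.
  edgeCode : Vertex → Vertex → Fin (order * order)
  edgeCode u v with toℕ (index u) ≤? toℕ (index v)
  ... | yes _ = combine (index u) (index v)
  ... | no  _ = combine (index v) (index u)

  edgeCode-sym : ∀ u v → edgeCode u v ≡ edgeCode v u
  edgeCode-sym u v with toℕ (index u) ≤? toℕ (index v) | toℕ (index v) ≤? toℕ (index u)
  ... | yes p | yes q = let eq = Fin.toℕ-injective (ℕ.≤-antisym p q) in
                        cong₂ combine eq (sym eq)
  ... | yes _ | no  _ = refl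
  ... | no  _ | yes _ = refl
  ... | no ¬p | no ¬q = contradiction (ℕ.<⇒≤ (ℕ.≰⇒> ¬p)) ¬q

  edgeCode-cases : ∀ u v → edgeCode u v ≡ combine (index u) (index v) ⊎
                           edgeCode u v ≡ combine (index v) (index u)
  edgeCode-cases u v with toℕ (index u) ≤? toℕ (index v)
  ... | yes _ = inj₁ refl
  ... | no  _ = inj₂ refl

  edgeCode-injective : ∀ u v a b → edgeCode u v ≡ edgeCode a b → u ≡ a ⊎ u ≡ b
  edgeCode-injective u v a b eq with edgeCode-cases u v | edgeCode-cases a b
  ... | inj₁ p | inj₁ q = inj₁ (index-injective
          (Fin.combine-injectiveˡ {order} {order} _ _ _ _ (trans (sym p) (trans eq q))))
  ... | inj₁ p | inj₂ q = inj₂ (index-injective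
          (Fin.combine-injectiveˡ {order} {order} _ _ _ _ (trans (sym p) (trans eq q))))
  ... | inj₂ p | inj₁ q = inj₂ (index-injective
          (Fin.combine-injectiveʳ {order} {order} _ _ _ _ (trans (sym p) (trans eq q))))
  ... | inj₂ p | inj₂ q = inj₁ (index-injective
          (Fin.combine-injectiveʳ {order} {order} _ _ _ _ (trans (sym p) (trans eq q))))

  tableColouring : ∀ {k} → Vec (Fin k) (order * order) → Colouring G k
  tableColouring t .colour     {u} {v} _ = Vec.lookup t (edgeCode u v)
  tableColouring t .colour-sym {u} {v} _ = cong (Vec.lookup t) (edgeCode-sym v u)

  module _ {k : ℕ} (c : Colouring G (suc k)) where

    pairColour : Vertex → Vertex → Fin (suc k)
    pairColour u v with adj? u v
    ... | yes e = colour c e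
    ... | no  _ = zero

    pairColour-adj : ∀ {u v} (e : Adj u v) → pairColour u v ≡ colour c e
    pairColour-adj {u} {v} e with adj? u v
    ... | yes e′ = cong (colour c) (adj-irrelevant e′ e)
    ... | no  ¬e = contradiction e ¬e

    codeColour : Fin (order * order) → Fin (suc k)
    codeColour = uncurry (λ a b → pairColour (vertex a) (vertex b)) ∘ remQuot order

    codeColour-combine : ∀ u v → codeColour (combine (index u) (index v)) ≡ pairColour u v
    codeColour-combine u v =
      trans (cong (uncurry λ a b → pairColour (vertex a) (vertex b))
                  (Fin.remQuot-combine {order} {order} (index u) (index v)))
            (cong₂ pairColour (vertex-index u) (vertex-index v))

    table : Vec (Fin (suc k)) (order * order)
    table = Vec.tabulate codeColour

    table-colour : ∀ {u v} (e : Adj u v) → colour c e ≡ colour (tableColouring table) e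
    table-colour {u} {v} e = sym (trans (lookup∘tabulate codeColour (edgeCode u v)) at)
      where
      at : codeColour (edgeCode u v) ≡ colour c e
      at with edgeCode-cases u v
      ... | inj₁ p = trans (cong codeColour p)
                       (trans (codeColour-combine u v) (pairColour-adj e))
      ... | inj₂ p = trans (cong codeColour p)
                       (trans (codeColour-combine v u)
                         (trans (pairColour-adj (adj-sym e)) (colour-sym c e)))

  module _ {k : ℕ} where

    colours-cong : (c d : Colouring G k) → (∀ {u v} (e : Adj u v) → colour c e ≡ colour d e) →
                   ∀ {u v} (w : Walk G u v) → colours c w ≡ colours d w
    colours-cong c d eq []      = refl
    colours-cong c d eq (e ∷ w) = cong₂ _∷_ (eq e) (colours-cong c d eq w)

    isRainbow-cong : (c d : Colouring G k) → (∀ {u v} (e : Adj u v) → colour c e ≡ colour d e) →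
                     IsRainbow c → IsRainbow d
    isRainbow-cong c d eq rb u v =
      let w , p , q = rb u v in w , p , subst Unique (colours-cong c d eq w) q

    length-colours : ∀ (c : Colouring G k) {u v} (w : Walk G u v) →
                     List.length (colours c w) ≡ length w
    length-colours c []      = refl
    length-colours c (e ∷ w) = cong suc (length-colours c w)

    rainbowPath? : ∀ (c : Colouring G k) u v → Dec (∃ λ (w : Walk G u v) → IsRainbowPath c w)
    rainbowPath? c u v =
      map′ (λ { (_ , w , _ , p) → w , p })
           (λ { (w , p , q) →
                let bound = s≤s (subst (_≤ k) (length-colours c w) (unique⇒length≤ q)) in
                fromℕ< bound , w , sym (Fin.toℕ-fromℕ< bound) , p , q })
           (Fin.any? {suc k} λ i → walkOfLength? G (toℕ i) λ w →
              isPath? G w ×-dec unique? Fin._≟_ (colours c w))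

    isRainbow? : Decidable (IsRainbow {G} {k})
    isRainbow? c = allVertices? λ u → allVertices? λ v → rainbowPath? c u v

  rainbowColourable? : Decidable (λ k → ∃ λ (c : Colouring G k) → IsRainbow c)
  rainbowColourable? (suc k) =
    map′ (λ (t , rb) → tableColouring t , rb)
         (λ (c , rb) → table c ,
            isRainbow-cong c (tableColouring (table c)) (table-colour c) rb)
         (anyVec? (order * order) (isRainbow? ∘ tableColouring))
  rainbowColourable? zero with anyVertex? (λ u → anyVertex? (adj? u))
  ... | yes (_ , _ , e) = no λ (c , _) → Fin.¬Fin0 (colour c e)
  ... | no ¬edge        =
    map′ (empty ,_)
         (λ (c , rb) → isRainbow-cong c empty (λ e → ⊥-elim (¬edge (_ , _ , e))) rb)
         (isRainbow? empty)
    where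
    empty : Colouring G 0
    empty .colour     e = ⊥-elim (¬edge (_ , _ , e))
    empty .colour-sym e = ⊥-elim (¬edge (_ , _ , e))

  codeColouring : Colouring G (order * order)
  codeColouring .colour     {u} {v} _ = edgeCode u v
  codeColouring .colour-sym {u} {v} _ = edgeCode-sym v u

  source∈ : ∀ {u v} (w : Walk G u v) → u ∈ vertices w
  source∈ []      = here refl
  source∈ (_ ∷ _) = here refl

  codeColouring-fresh : ∀ {x y u v} (w : Walk G u v) → All (x ≢_) (vertices w) →
                        All (edgeCode x y ≢_) (colours codeColouring w)
  codeColouring-fresh []      _           = []
  codeColouring-fresh {x} {y} {u} (_∷_ {w = a} e w) (x≢u ∷ x∉w) = head ∷ codeColouring-fresh w x∉w
    where
    head : edgeCode x y ≢ edgeCode u a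
    head eq with edgeCode-injective x y u a eq
    ... | inj₁ x≡u = x≢u x≡u
    ... | inj₂ x≡a = All.lookup x∉w (source∈ w) x≡a

  codeColouring-unique : ∀ {u v} (w : Walk G u v) → IsPath w → Unique (colours codeColouring w)
  codeColouring-unique []      _         = []
  codeColouring-unique (e ∷ w) (u∉ ∷ p) = codeColouring-fresh w u∉ ∷ codeColouring-unique w p

  rainbowConnectionNumber-exists : Connected G → ∃ (IsRainbowConnectionNumber G)
  rainbowConnectionNumber-exists conn =
    minimum rainbowColourable?
      (order * order , codeColouring , λ u v →
        let w , p = conn u v in w , p , codeColouring-unique w p)

radius : (G : Graph) → Connected G → NonTrivial G → ℕ
radius G conn nt = proj₁ (radius-exists G conn nt)

radius-correct : ∀ G conn nt → IsRadius G (radius G conn nt)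
radius-correct G conn nt = proj₂ (radius-exists G conn nt)

rc : (G : Graph) → Connected G → ℕ
rc G conn = proj₁ (rainbowConnectionNumber-exists G conn)

rc-correct : ∀ G conn → IsRainbowConnectionNumber G (rc G conn)
rc-correct G conn = proj₂ (rainbowConnectionNumber-exists G conn)

module _ (G H : Graph) where
  private
    module G = Graph G
    module H = Graph H

  StrongAdj : Rel (G.Vertex × H.Vertex) 0ℓ
  StrongAdj (g₁ , h₁) (g₂ , h₂) =
    (g₁ ≡ g₂ × H.Adj h₁ h₂) ⊎
    (h₁ ≡ h₂ × G.Adj g₁ g₂) ⊎
    (G.Adj g₁ g₂ × H.Adj h₁ h₂)

  strongAdj-irrelevant : Irrelevant₂ StrongAdj
  strongAdj-irrelevant (inj₁ (refl , f))        (inj₁ (refl , f′))       =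
    cong (λ x → inj₁ (refl , x)) (H.adj-irrelevant f f′)
  strongAdj-irrelevant (inj₁ (refl , f))        (inj₂ (inj₁ (_ , e′)))    = ⊥-elim (G.adj-irrefl e′)
  strongAdj-irrelevant (inj₁ (refl , f))        (inj₂ (inj₂ (e′ , _)))    = ⊥-elim (G.adj-irrefl e′)
  strongAdj-irrelevant (inj₂ (inj₁ (refl , e))) (inj₁ (_ , f′))          = ⊥-elim (H.adj-irrefl f′)
  strongAdj-irrelevant (inj₂ (inj₁ (refl , e))) (inj₂ (inj₁ (refl , e′))) =
    cong (λ x → inj₂ (inj₁ (refl , x))) (G.adj-irrelevant e e′)
  strongAdj-irrelevant (inj₂ (inj₁ (refl , e))) (inj₂ (inj₂ (_ , f′)))    = ⊥-elim (H.adj-irrefl f′)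
  strongAdj-irrelevant (inj₂ (inj₂ (e , f)))    (inj₁ (refl , _))        = ⊥-elim (G.adj-irrefl e)
  strongAdj-irrelevant (inj₂ (inj₂ (e , f)))    (inj₂ (inj₁ (refl , _)))  = ⊥-elim (H.adj-irrefl f)
  strongAdj-irrelevant (inj₂ (inj₂ (e , f)))    (inj₂ (inj₂ (e′ , f′)))   =
    cong₂ (λ x y → inj₂ (inj₂ (x , y))) (G.adj-irrelevant e e′) (H.adj-irrelevant f f′)

  infixr 7 _⊠_
  _⊠_ : Graph
  _⊠_ .Graph.Vertex         = G.Vertex × H.Vertex
  _⊠_ .Graph.order          = G.order * H.order
  _⊠_ .Graph.enumeration    = ↔-sym Fin.*↔× ↔-∘ (G.enumeration ×-↔ H.enumeration)
  _⊠_ .Graph.Adj            = StrongAdj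
  _⊠_ .Graph.adj? (g₁ , h₁) (g₂ , h₂) =
    (g₁ G.≟ g₂ ×-dec H.adj? h₁ h₂) ⊎-dec
    (h₁ H.≟ h₂ ×-dec G.adj? g₁ g₂) ⊎-dec
    (G.adj? g₁ g₂ ×-dec H.adj? h₁ h₂)
  _⊠_ .Graph.adj-sym (inj₁ (eq , f))        = inj₁ (sym eq , H.adj-sym f)
  _⊠_ .Graph.adj-sym (inj₂ (inj₁ (eq , e))) = inj₂ (inj₁ (sym eq , G.adj-sym e))
  _⊠_ .Graph.adj-sym (inj₂ (inj₂ (e , f)))  = inj₂ (inj₂ (G.adj-sym e , H.adj-sym f))
  _⊠_ .Graph.adj-irrefl (inj₁ (_ , f))        = H.adj-irrefl f
  _⊠_ .Graph.adj-irrefl (inj₂ (inj₁ (_ , e))) = G.adj-irrefl e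
  _⊠_ .Graph.adj-irrefl (inj₂ (inj₂ (e , _))) = G.adj-irrefl e
  _⊠_ .Graph.adj-irrelevant = strongAdj-irrelevant

⊠-nonTrivial : ∀ {G H} → NonTrivial G → NonTrivial H → NonTrivial (G ⊠ H)
⊠-nonTrivial ntG ntH = ℕ.≤-trans (s≤s (s≤s z≤n)) (ℕ.*-mono-≤ ntG ntH)

module _ {G : Graph} where
  open Graph G

  _++_ : ∀ {u v w} → Walk G u v → Walk G v w → Walk G u w
  []      ++ q = q
  (e ∷ p) ++ q = e ∷ (p ++ q)

  dropTo : ∀ {u v x} (w : Walk G u v) → IsPath w → x ∈ vertices w →
           ∃ λ (w′ : Walk G x v) → IsPath w′
  dropTo []      p       (here refl) = [] , p
  dropTo (e ∷ w) p       (here refl) = e ∷ w , p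
  dropTo (e ∷ w) (_ ∷ p) (there x∈)  = dropTo w p x∈

  walk⇒path : ∀ {u v} → Walk G u v → ∃ λ (w : Walk G u v) → IsPath w
  walk⇒path []          = [] , [] ∷ []
  walk⇒path {u} (e ∷ w) with walk⇒path w
  ... | w′ , p with Any.any? (u ≟_) (vertices w′)
  ...   | yes u∈ = dropTo w′ p u∈
  ...   | no  u∉ = e ∷ w′ , ¬Any⇒All¬ _ u∉ ∷ p

⊠-connected : ∀ {G H} → Connected G → Connected H → Connected (G ⊠ H)
⊠-connected {G} {H} connG connH (g₁ , h₁) (g₂ , h₂) =
  walk⇒path (left (proj₁ (connG g₁ g₂)) ++ right (proj₁ (connH h₁ h₂)))
  where
  left : ∀ {a b h} → Walk G a b → Walk (G ⊠ H) (a , h) (b , h)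
  left []      = []
  left (e ∷ w) = inj₂ (inj₁ (refl , e)) ∷ left w

  right : ∀ {a b g} → Walk H a b → Walk (G ⊠ H) (g , a) (g , b)
  right []      = []
  right (f ∷ w) = inj₁ (refl , f) ∷ right w

{-# OPTIONS --safe #-}

-- Upper bound: let r be the radius of G ⊠ H, attained at (g₀ , h₀).  The rank
-- of (g , h) is the larger of its levels d(g₀ , g) and d(h₀ , h), and its class
-- is the parity of their sum.  Moving in both coordinates at once (oscillating
-- between h₀ and a neighbour once h has reached h₀, and likewise in G) lowers
-- the rank by one and keeps the class.  So giving each class its own r colours,
-- indexed by rank, yields rainbow descents to the centre, and descents from
-- vertices of different classes use different colours.  Two vertices of the
-- same class are joined by first changing class at one of them, along an edge
-- away from the centre, all such edges sharing one extra colour.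
-- Lower bound: a rainbow path has at most rc edges.

module Submission where

open import Defs
open import Data.Fin using (Fin; toℕ; fromℕ<)
import Data.Fin.Properties as Fin
open import Data.List.Membership.Propositional using (_∈_)
open import Data.List.Relation.Unary.All as All using (All; []; _∷_)
open import Data.List.Relation.Unary.All.Properties using (¬Any⇒All¬)
open import Data.List.Relation.Unary.AllPairs using ([]; _∷_)
open import Data.List.Relation.Unary.Any as Any using (here; there)
open import Data.List.Relation.Unary.Unique.Propositional using (Unique)
open import Data.Nat hiding (_≟_; NonTrivial)
open import Data.Nat.Properties hiding (_≟_)
open import Data.Parity using (Parity; 0ℙ; 1ℙ; _⁻¹)
open import Data.Parity.Properties using (suc-homo-⁻¹; _≟_)
open import Data.Product using (∃; ∃₂; _×_; _,_; proj₁; proj₂)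
open import Data.Sum using (_⊎_; inj₁; inj₂)
open import Data.Unit using (⊤; tt)
open import Function using (_∘_; Inverse)
open import Relation.Binary.PropositionalEquality
open import Relation.Nullary using (¬_; yes; no; contradiction)
open import Relation.Unary using (Pred; _⊆_; _∩_; _∪_)
open import Level using (0ℓ)

open Colouring

-- Rainbow walks with prescribed colour sets.

module _ {G : Graph} {k : ℕ} (c : Colouring G k) where
  open Graph G renaming (_≟_ to _≟ᵥ_)

  -- Vertices may repeat; only the colour set `S` is tracked, so that pieces with disjoint sets can
  -- be glued. Loops are removed at the very end.
  RainbowWalk : Pred (Fin k) 0ℓ → Vertex → Vertex → Set
  RainbowWalk S u v =
    ∃ λ (w : Walk G u v) → Unique (colours c w) × All S (colours c w)

  RainbowPath : Pred (Fin k) 0ℓ → Vertex → Vertex → Set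
  RainbowPath S u v =
    ∃ λ (w : Walk G u v) → IsPath w × Unique (colours c w) × All S (colours c w)

  weaken : ∀ {S T u v} → S ⊆ T → RainbowWalk S u v → RainbowWalk T u v
  weaken S⊆T (w , uniq , all) = w , uniq , All.map S⊆T all

  cons : ∀ {S u v w} (e : Adj u v) → S (colour c e) →
         RainbowWalk (S ∩ (colour c e ≢_)) v w → RainbowWalk S u w
  cons e s (w , uniq , all) = e ∷ w , All.map proj₂ all ∷ uniq , s ∷ All.map proj₁ all

  concat : ∀ {S T u v w} → (∀ {x} → S x → ¬ T x) →
           (p : Walk G u v) → Unique (colours c p) → All S (colours c p) →
           RainbowWalk T v w → RainbowWalk (S ∪ T) u w
  concat disj [] _ _ q = weaken inj₂ q
  concat {S} {T} disj (e ∷ p) (e∉ ∷ uniq) (s ∷ all) q =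
    -- The recursive call shrinks `S` by the colour of `e`, which records that this colour does not
    -- recur in the rest.
    cons e (inj₁ s) (weaken restrict (concat (disj ∘ proj₁) p uniq (All.zip (all , e∉)) q))
    where
    restrict : ((S ∩ (colour c e ≢_)) ∪ T) ⊆ ((S ∪ T) ∩ (colour c e ≢_))
    restrict (inj₁ (s , e≢)) = inj₁ s , e≢
    restrict (inj₂ t)        = inj₂ t , λ { refl → disj s t }

  reverse : ∀ {S u v} (w : Walk G u v) → Unique (colours c w) → All S (colours c w) →
            RainbowWalk S v u
  reverse [] _ _ = [] , [] , []
  reverse {S} (e ∷ w) (e∉ ∷ uniq) (s ∷ all) =
    let w′ , uniq′ , all′ = reverse w uniq (All.zip (all , e∉)) in
    weaken merge
      (concat proj₂ w′ uniq′ all′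
        (adj-sym e ∷ [] , [] ∷ [] , sym (colour-sym c e) ∷ []))
    where
    merge : ((S ∩ (colour c e ≢_)) ∪ (colour c e ≡_)) ⊆ S
    merge (inj₁ (s , _)) = s
    merge (inj₂ refl)    = s

  rainbowSuffix : ∀ {S u v x} (w : Walk G u v) → IsPath w → Unique (colours c w) →
                  All S (colours c w) → x ∈ vertices w → RainbowPath S x v
  rainbowSuffix []      p       uniq       all       (here refl) = [] , p , uniq , all
  rainbowSuffix (e ∷ w) p       uniq       all       (here refl) = e ∷ w , p , uniq , all
  rainbowSuffix (e ∷ w) (_ ∷ p) (_ ∷ uniq) (_ ∷ all) (there x∈)  = rainbowSuffix w p uniq all x∈

  -- If `u` recurs in the path for the tail, its suffix from `u` is taken; the colours of a suffix
  -- stay distinct and in `S`.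
  rainbowWalk⇒rainbowPath : ∀ {S u v} (w : Walk G u v) → Unique (colours c w) →
                            All S (colours c w) → RainbowPath S u v
  rainbowWalk⇒rainbowPath [] uniq all = [] , [] ∷ [] , uniq , all
  rainbowWalk⇒rainbowPath {u = u} (e ∷ w) (e∉ ∷ uniq) (s ∷ all)
    with rainbowWalk⇒rainbowPath w uniq (All.zip (all , e∉))
  ... | w′ , p , uniq′ , all′ with Any.any? (u ≟ᵥ_) (vertices w′)
  ...   | yes u∈ = rainbowSuffix w′ p uniq′ (All.map proj₁ all′) u∈
  ...   | no  u∉ = e ∷ w′ , ¬Any⇒All¬ _ u∉ ∷ p , All.map proj₂ all′ ∷ uniq′ , s ∷ All.map proj₁ all′

-- Moves between distance levels in a factor.

data Step : ℕ → ℕ → Set where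
  down : ∀ {i} → Step (suc i) i
  up   : Step 0 1

module Levels (G : Graph) (conn : Connected G) (root : Graph.Vertex G) where
  open Graph G

  -- Walks have the same least length as paths and allow an edge to be prepended freely; `⊤` fits
  -- the form that `walkOfLength?` decides.
  HasWalk : Vertex → ℕ → Set
  HasWalk v n = ∃ λ (w : Walk G v root) → length w ≡ n × ⊤

  shortest : ∀ v → ∃ (IsMinimum (HasWalk v))
  shortest v =
    minimum (λ n → walkOfLength? G n (λ _ → yes tt))
            (let w , _ = conn v root in length w , w , refl , tt)

  level : Vertex → ℕ
  level v = proj₁ (shortest v)

  level-minimal : ∀ {v} (w : Walk G v root) → level v ≤ length w
  level-minimal {v} w = proj₂ (proj₂ (shortest v)) _ (w , refl , tt)

  level-root : level root ≡ 0
  level-root = n≤0⇒n≡0 (level-minimal [])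

  level≡0⇒root : ∀ {v} → level v ≡ 0 → v ≡ root
  level≡0⇒root {v} eq with proj₁ (proj₂ (shortest v))
  ... | []    , _       = refl
  ... | e ∷ w , eq′ , _ = contradiction (trans eq′ eq) λ ()

  level-adj : ∀ {u v} → Adj u v → level u ≤ suc (level v)
  level-adj {v = v} e with proj₁ (proj₂ (shortest v))
  ... | w , eq , _ = subst (λ n → _ ≤ suc n) eq (level-minimal (e ∷ w))

  -- Take the second vertex of a shortest walk to the root: the rest of that walk bounds its level
  -- from above, `level-adj` from below.
  predecessor : ∀ {v i} → level v ≡ suc i → ∃ λ u → Adj v u × level u ≡ i
  predecessor {v} eq with proj₁ (proj₂ (shortest v))
  ... | []    , eq′ , _ = contradiction (trans eq′ eq) λ ()
  ... | e ∷ w , eq′ , _ = _ , e , ≤-antisym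
          (≤-trans (level-minimal w) (s≤s⁻¹ (≤-reflexive (trans eq′ eq))))
          (s≤s⁻¹ (≤-trans (≤-reflexive (sym eq)) (level-adj e)))

  source≡target⊎neighbour : ∀ {u v} → Walk G u v → u ≡ v ⊎ ∃ (Adj u)
  source≡target⊎neighbour []      = inj₁ refl
  source≡target⊎neighbour (e ∷ _) = inj₂ (_ , e)

  nonTrivial⇒neighbour : NonTrivial G → ∀ u → ∃ (Adj u)
  nonTrivial⇒neighbour nt u
    with source≡target⊎neighbour (proj₁ (conn u (vertex (fromℕ< (<⇒≤ nt)))))
       | source≡target⊎neighbour (proj₁ (conn u (vertex (fromℕ< nt))))
  ... | inj₂ n  | _       = n
  ... | inj₁ _  | inj₂ n  = n
  ... | inj₁ eq | inj₁ eq′ = contradiction index₀≡index₁ λ ()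
    where
    index₀≡index₁ : 0 ≡ 1
    index₀≡index₁ = begin
      0                                        ≡⟨ Fin.toℕ-fromℕ< (<⇒≤ nt) ⟨
      toℕ (fromℕ< (<⇒≤ nt))                    ≡⟨ cong toℕ (strictlyInverseˡ _) ⟨
      toℕ (index (vertex (fromℕ< (<⇒≤ nt))))   ≡⟨ cong (toℕ ∘ index) (trans (sym eq) eq′) ⟩
      toℕ (index (vertex (fromℕ< nt)))         ≡⟨ cong toℕ (strictlyInverseˡ _) ⟩
      toℕ (fromℕ< nt)                          ≡⟨ Fin.toℕ-fromℕ< nt ⟩
      1                                        ∎
      where
      open ≡-Reasoning
      open Inverse enumeration using (strictlyInverseˡ)

  -- For `up`, a neighbour of the root has level at most one, and level zero would make it the root,
  -- which has no loop.
  step : NonTrivial G → ∀ {v i j} → Step i j → level v ≡ i → ∃ λ u → Adj v u × level u ≡ j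
  step nt down eq = predecessor eq
  step nt {v} up eq with level≡0⇒root eq | nonTrivial⇒neighbour nt v
  ... | refl | u , e = u , e , ≤-antisym
          (subst (λ n → level u ≤ suc n) eq (level-adj (adj-sym e)))
          (n≢0⇒n>0 λ level-u≡0 →
            adj-irrefl (subst (Adj root) (level≡0⇒root level-u≡0) e))

-- Arithmetic of level pairs.

data Stride : ℕ × ℕ → ℕ × ℕ → Set where
  left  : ∀ {i i′ j}    → Step i i′ → Stride (i , j) (i′ , j)
  right : ∀ {i j j′}    → Step j j′ → Stride (i , j) (i , j′)
  both  : ∀ {i i′ j j′} → Step i i′ → Step j j′ → Stride (i , j) (i′ , j′)

rank : ℕ × ℕ → ℕ
rank (i , j) = i ⊔ j

class : ℕ × ℕ → Parity
class (i , j) = parity (i + j)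

parity-suc : ∀ n → parity (suc n) ≡ parity n ⁻¹
parity-suc n = sym (suc-homo-⁻¹ (suc n))

rank≡0⇒origin : ∀ p → rank p ≡ 0 → p ≡ (0 , 0)
rank≡0⇒origin (zero  , zero)  _ = refl
rank≡0⇒origin (zero  , suc _) ()
rank≡0⇒origin (suc _ , suc _) ()

-- Moving both coordinates by one keeps the parity of their sum. Only from (0 , 1) and (1 , 0) is a
-- single coordinate moved; there `k ≡ 0` and the move ends at the origin.
descending : ∀ k p → rank p ≡ suc k →
             ∃ λ q → Stride p q × rank q ≡ k × (k ≡ 0 ⊎ class q ≡ class p)
descending k (zero        , suc zero)    refl = _ , right down , refl , inj₁ refl
descending k (zero        , suc (suc j)) refl = _ , both up down , refl , inj₂ refl
descending k (suc zero    , zero)        refl = _ , left down , refl , inj₁ refl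
descending k (suc (suc i) , zero)        refl =
  _ , both down up , cong suc (⊔-identityʳ i) , inj₂ (cong (parity ∘ suc) (+-suc i 0))
descending k (suc i       , suc j)       eq   =
  _ , both down down , suc-injective eq , inj₂ (sym (cong (parity ∘ suc) (+-suc i j)))

-- Moving one coordinate flips the class. The target must have positive rank, as edges at the origin
-- do not carry the extra colour; hence (0 , 1) and (1 , 0) go up to (1 , 1).
crossing : ∀ k p → rank p ≡ suc k →
           ∃₂ λ q m → Stride p q × rank q ≡ suc m × class p ≡ class q ⁻¹
crossing k (zero        , suc zero)    refl = (1 , 1) , _ , left up , refl , refl
crossing k (zero        , suc (suc j)) refl = _ , _ , right down , refl , parity-suc (suc j)
crossing k (suc zero    , zero)        refl = (1 , 1) , _ , right up , refl , refl
crossing k (suc (suc i) , zero)        refl = _ , _ , left down , refl , parity-suc (suc (i + 0))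
crossing k (suc zero    , suc j)       eq   = _ , _ , left down , refl , parity-suc (suc j)
crossing k (suc (suc i) , suc j)       eq   = _ , _ , left down , refl , parity-suc (suc i + suc j)

-- The palette and its bands.

module Shading (r : ℕ) where

  -- Colours below `r` serve even descents, the next `r` serve odd ones, and `r + r` is the extra
  -- colour.
  base : Parity → ℕ
  base 0ℙ = 0
  base 1ℙ = r

  -- Arguments: smaller and larger rank of the ends of a class-changing edge.
  -- The centre is the only vertex of rank zero and has even class; its edges
  -- to odd vertices complete the odd descents, hence carry an odd colour.
  mixed : ℕ → ℕ → ℕ
  mixed zero    m = r + (m ∸ 1)
  mixed (suc _) m = r + r

  -- Within a class, `m ⊔ n ∸ 1` is the rank of the lower end of a descending edge, written
  -- symmetrically in its ends.
  shade : Parity → Parity → ℕ → ℕ → ℕ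
  shade 0ℙ 0ℙ m n = (m ⊔ n) ∸ 1
  shade 1ℙ 1ℙ m n = r + (m ⊔ n ∸ 1)
  shade 0ℙ 1ℙ m n = mixed (m ⊓ n) (m ⊔ n)
  shade 1ℙ 0ℙ m n = mixed (m ⊓ n) (m ⊔ n)

  shade-sym : ∀ s t m n → shade s t m n ≡ shade t s n m
  shade-sym 0ℙ 0ℙ m n rewrite ⊔-comm m n = refl
  shade-sym 1ℙ 1ℙ m n rewrite ⊔-comm m n = refl
  shade-sym 0ℙ 1ℙ m n rewrite ⊔-comm m n | ⊓-comm m n = refl
  shade-sym 1ℙ 0ℙ m n rewrite ⊔-comm m n | ⊓-comm m n = refl

  shade< : ∀ s t {m n} → m ≤ r → n ≤ r → shade s t m n < suc (r + r)
  shade< s t {m} {n} m≤r n≤r = s≤s (bound s t)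
    where
    top : m ⊔ n ∸ 1 ≤ r
    top = ≤-trans (m∸n≤m (m ⊔ n) 1) (⊔-lub m≤r n≤r)

    mixed≤ : ∀ l → mixed l (m ⊔ n) ≤ r + r
    mixed≤ zero    = +-monoʳ-≤ r top
    mixed≤ (suc _) = ≤-refl

    bound : ∀ s t → shade s t m n ≤ r + r
    bound 0ℙ 0ℙ = ≤-trans top (m≤m+n r r)
    bound 1ℙ 1ℙ = +-monoʳ-≤ r top
    bound 0ℙ 1ℙ = mixed≤ (m ⊓ n)
    bound 1ℙ 0ℙ = mixed≤ (m ⊓ n)

  shade-same : ∀ s k → shade s s (suc k) k ≡ base s + k
  shade-same 0ℙ k = cong (_∸ 1) (m≥n⇒m⊔n≡m (n≤1+n k))
  shade-same 1ℙ k = cong (λ m → r + (m ∸ 1)) (m≥n⇒m⊔n≡m (n≤1+n k))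

  shade-centre : ∀ s → shade s 0ℙ 1 0 ≡ base s + 0
  shade-centre 0ℙ = refl
  shade-centre 1ℙ = refl

  shade-crossing : ∀ s m n → shade s (s ⁻¹) (suc m) (suc n) ≡ r + r
  shade-crossing 0ℙ m n = refl
  shade-crossing 1ℙ m n = refl

  Band : Parity → ℕ → Pred ℕ 0ℓ
  Band s k n = base s ≤ n × n < base s + k

  band-disjoint : ∀ {s t n} → s ≢ t → Band s r n → ¬ Band t r n
  band-disjoint {0ℙ} {0ℙ} s≢t _ _                 = s≢t refl
  band-disjoint {0ℙ} {1ℙ} s≢t (_ , n<r) (r≤n , _) = <⇒≱ n<r r≤n
  band-disjoint {1ℙ} {0ℙ} s≢t (r≤n , _) (_ , n<r) = <⇒≱ n<r r≤n
  band-disjoint {1ℙ} {1ℙ} s≢t _ _                 = s≢t refl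

  band< : ∀ s {n} → Band s r n → n < r + r
  band< 0ℙ (_ , n<) = <-≤-trans n< (m≤m+n r r)
  band< 1ℙ (_ , n<) = n<

  edgeShade : ℕ × ℕ → ℕ × ℕ → ℕ
  edgeShade p q = shade (class p) (class q) (rank p) (rank q)

  edgeShade-crossing : ∀ p q {m n} → rank p ≡ suc m → rank q ≡ suc n → class p ≡ class q ⁻¹ →
                       edgeShade q p ≡ r + r
  edgeShade-crossing p q {m} {n} p≡ q≡ eq rewrite p≡ | q≡ | eq = shade-crossing (class q) n m

  edgeShade-descending : ∀ p q {k} → rank p ≡ suc k → rank q ≡ k →
                         k ≡ 0 ⊎ class q ≡ class p → edgeShade p q ≡ base (class p) + k
  -- The lower end is the origin, of even class, so `shade-centre` covers either class of `p`.
  edgeShade-descending p q p≡ q≡ (inj₁ refl)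
    rewrite rank≡0⇒origin q q≡ | p≡ = shade-centre (class p)
  edgeShade-descending p q {k} p≡ q≡ (inj₂ eq)
    rewrite p≡ | q≡ | eq = shade-same (class p) k

-- Levels in the strong product.

module _ (G H : Graph) (connG : Connected G) (connH : Connected H)
         (ntG : NonTrivial G) (ntH : NonTrivial H) (centre : Graph.Vertex (G ⊠ H)) where

  private
    module LG = Levels G connG (proj₁ centre)
    module LH = Levels H connH (proj₂ centre)
    module P = Graph (G ⊠ H)

  levels : P.Vertex → ℕ × ℕ
  levels (g , h) = LG.level g , LH.level h

  stride : ∀ {p b} → Stride (levels p) b → ∃ λ q → P.Adj p q × levels q ≡ b
  stride {g , h} (left s) =
    let g′ , e , eq = LG.step ntG s refl in (g′ , h) , inj₂ (inj₁ (refl , e)) , cong (_, _) eq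
  stride {g , h} (right s) =
    let h′ , f , eq = LH.step ntH s refl in (g , h′) , inj₁ (refl , f) , cong (_ ,_) eq
  stride {g , h} (both s t) =
    let g′ , e , eq  = LG.step ntG s refl
        h′ , f , eq′ = LH.step ntH t refl
    in  (g′ , h′) , inj₂ (inj₂ (e , f)) , cong₂ _,_ eq eq′

  rank-adj : ∀ {p q} → P.Adj p q → rank (levels q) ≤ suc (rank (levels p))
  rank-adj {p} {q} e = ⊔-mono-≤ (first e) (second e)
    where
    first : P.Adj p q → LG.level (proj₁ q) ≤ suc (LG.level (proj₁ p))
    first (inj₁ (refl , _))     = n≤1+n _
    first (inj₂ (inj₁ (_ , e))) = LG.level-adj (Graph.adj-sym G e)
    first (inj₂ (inj₂ (e , _))) = LG.level-adj (Graph.adj-sym G e)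

    second : P.Adj p q → LH.level (proj₂ q) ≤ suc (LH.level (proj₂ p))
    second (inj₁ (_ , f))          = LH.level-adj (Graph.adj-sym H f)
    second (inj₂ (inj₁ (refl , _))) = n≤1+n _
    second (inj₂ (inj₂ (_ , f)))    = LH.level-adj (Graph.adj-sym H f)

  -- An edge of the product raises each level by at most one. This ties levels, measured in the
  -- factors, to the radius of the product.
  rank-walk : ∀ {p q} (w : Walk (G ⊠ H) p q) → rank (levels q) ≤ length w + rank (levels p)
  rank-walk []      = ≤-refl
  rank-walk {p} (_∷_ {w = q} e w) =
    ≤-trans (rank-walk w)
      (≤-trans (+-monoʳ-≤ (length w) (rank-adj {p} {q} e)) (≤-reflexive (+-suc (length w) _)))

  levels-centre : levels centre ≡ (0 , 0)
  levels-centre = cong₂ _,_ LG.level-root LH.level-root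

  rank≡0⇒centre : ∀ p → rank (levels p) ≡ 0 → p ≡ centre
  rank≡0⇒centre p eq =
    let eq′ = rank≡0⇒origin (levels p) eq
    in  cong₂ _,_ (LG.level≡0⇒root (cong proj₁ eq′)) (LH.level≡0⇒root (cong proj₂ eq′))

  -- Rainbow walks through the centre.

  module Rainbow (r : ℕ) (rank≤r : ∀ p → rank (levels p) ≤ r) where
    open Shading r

    hue : P.Vertex → P.Vertex → ℕ
    hue p q = edgeShade (levels p) (levels q)

    hue< : ∀ p q → hue p q < suc (r + r)
    hue< p q = shade< (class (levels p)) (class (levels q)) (rank≤r p) (rank≤r q)

    colouring : Colouring (G ⊠ H) (suc (r + r))
    colouring .colour {p} {q} _ = fromℕ< (hue< p q)
    colouring .colour-sym {p} {q} _ =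
      Fin.fromℕ<-cong _ _
        (shade-sym (class (levels q)) (class (levels p)) (rank (levels q)) (rank (levels p))) _ _

    toℕ-colour : ∀ p q (e : P.Adj p q) → toℕ (colour colouring {p} {q} e) ≡ hue p q
    toℕ-colour p q _ = Fin.toℕ-fromℕ< (hue< p q)

    HueWalk : Pred ℕ 0ℓ → P.Vertex → P.Vertex → Set
    HueWalk S = RainbowWalk colouring (S ∘ toℕ)

    -- Induction on the rank: the first edge takes the top colour of the band, and the rest of the
    -- walk uses the band below it.
    descent : ∀ k p → rank (levels p) ≡ k → HueWalk (Band (class (levels p)) k) p centre
    descent zero p eq with rank≡0⇒centre p eq
    ... | refl = [] , [] , []
    descent (suc k) p eq with descending k (levels p) eq
    ... | b , s , b≡k , stays with stride s
    ... | q , e , refl = cons colouring {w = centre} e fits (tail stays)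
      where
      t : Parity
      t = class (levels p)

      hue≡ : toℕ (colour colouring {p} {q} e) ≡ base t + k
      hue≡ = trans (toℕ-colour p q e) (edgeShade-descending (levels p) (levels q) eq b≡k stays)

      fits : Band t (suc k) (toℕ (colour colouring {p} {q} e))
      fits rewrite hue≡ = m≤m+n (base t) k , +-monoʳ-< (base t) (n<1+n k)

      fresh : ∀ {x} → Band t k (toℕ x) →
              Band t (suc k) (toℕ x) × colour colouring {p} {q} e ≢ x
      fresh (lo , hi) =
        (lo , <-trans hi (+-monoʳ-< (base t) (n<1+n k))) ,
        λ { refl → <-irrefl hue≡ hi }

      tail : k ≡ 0 ⊎ class (levels q) ≡ t →
             RainbowWalk colouring
               ((Band t (suc k) ∘ toℕ) ∩ (colour colouring {p} {q} e ≢_)) q centre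
      -- The class may change only on the edge into the centre, after which no walk remains.
      tail (inj₁ refl) with rank≡0⇒centre q b≡k
      ... | refl = [] , [] , []
      tail (inj₂ same) =
        weaken colouring fresh
          (subst (λ s → HueWalk (Band s k) q centre) same (descent k q b≡k))

    bandDescent : ∀ p → HueWalk (Band (class (levels p)) r) p centre
    bandDescent p =
      weaken colouring
        (λ (lo , hi) → lo , <-≤-trans hi (+-monoʳ-≤ (base (class (levels p))) (rank≤r p)))
        (descent (rank (levels p)) p refl)

    -- Staying below `r + r` leaves the extra colour free for one more edge.
    viaCentre : ∀ p q → class (levels p) ≢ class (levels q) → HueWalk (_< r + r) p q
    viaCentre p q p≢q =
      let w , uniq , all = bandDescent p
          x , uniq′ , all′ = bandDescent q
      in  weaken colouring
            (λ { (inj₁ b) → band< (class (levels p)) b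
               ; (inj₂ b) → band< (class (levels q)) b })
            (concat colouring (band-disjoint p≢q) w uniq all (reverse colouring x uniq′ all′))

    rainbowWalk : ∀ p q → HueWalk (_≤ r + r) p q
    rainbowWalk p q with class (levels p) ≟ class (levels q)
    ... | no p≢q = weaken colouring <⇒≤ (viaCentre p q p≢q)
    ... | yes p≡q with rank (levels q) in eq
    ...   | zero with rank≡0⇒centre q eq
    ...     | refl = weaken colouring (<⇒≤ ∘ band< (class (levels p))) (bandDescent p)
    -- The class is changed at `q`: the walk goes to a neighbour `x` of the other class and reaches
    -- `q` by the crossing edge.
    rainbowWalk p q | yes p≡q | suc k with crossing k (levels q) eq
    ... | b , m , s , b≡m , opposite with stride s
    ... | x , e , refl =
      let w , uniq , all = viaCentre p x p≢x in
      weaken colouring (λ { (inj₁ x<) → <⇒≤ x< ; (inj₂ x≡) → ≤-reflexive x≡ })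
        (concat colouring (λ x< x≡ → <-irrefl x≡ x<) w uniq all
          (P.adj-sym {q} {x} e ∷ [] , [] ∷ [] , hue≡ ∷ []))
      where
      p≢x : class (levels p) ≢ class (levels x)
      p≢x p≡x = x≢x⁻¹ (class (levels x)) (trans (sym p≡x) (trans p≡q opposite))
        where
        x≢x⁻¹ : ∀ s → s ≢ s ⁻¹
        x≢x⁻¹ 0ℙ ()
        x≢x⁻¹ 1ℙ ()

      hue≡ : toℕ (colour colouring {x} {q} (P.adj-sym {q} {x} e)) ≡ r + r
      hue≡ = trans (toℕ-colour x q (P.adj-sym {q} {x} e))
                   (edgeShade-crossing (levels q) (levels x) eq b≡m opposite)

    isRainbow : IsRainbow colouring
    isRainbow p q =
      let w , uniq , all = rainbowWalk p q
          -- The walk may revisit vertices, as it does for `p` equal to `q` away from the centre.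
          w′ , path , uniq′ , _ = rainbowWalk⇒rainbowPath colouring w uniq all
      in  w′ , path , uniq′

-- The two inequalities.

isRadius≤isRC : ∀ {G r k} → IsRadius G r → IsRainbowConnectionNumber G k → r ≤ k
isRadius≤isRC {G} {k = k} ((v , (u , _ , isMin) , _) , _) ((c , rainbow) , _) =
  -- `u` is at distance `r` from the central vertex `v`, so the rainbow path between them has at
  -- least `r` edges.
  let w , path , uniq = rainbow v u in
  ≤-trans (isMin (length w) (w , refl , path))
    (subst (_≤ k) (length-colours G c w) (unique⇒length≤ uniq))

isRC≤2*isRadius+2 :
  ∀ {G H r k} → Connected G → Connected H → NonTrivial G → NonTrivial H →
  IsRadius (G ⊠ H) r → IsRainbowConnectionNumber (G ⊠ H) k → k ≤ 2 * r + 2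
isRC≤2*isRadius+2 {G} {H} {r} connG connH ntG ntH ((centre , _ , farthest) , _) (_ , minimal) =
  ≤-trans (minimal (suc (r + r)) (colouring , isRainbow)) 2r+1≤2r+2
  where
  rank≤r : ∀ p → rank (levels G H connG connH ntG ntH centre p) ≤ r
  rank≤r p =
    let d , isDist@((w , w≡d , _) , _) = distance (G ⊠ H) (⊠-connected connG connH) centre p in
    begin
      rank (lv p)                 ≤⟨ rank-walk G H connG connH ntG ntH centre w ⟩
      length w + rank (lv centre) ≡⟨ cong₂ (λ m b → m + rank b) w≡d lv-centre ⟩
      d + 0                       ≡⟨ +-identityʳ d ⟩
      d                           ≤⟨ farthest d (p , isDist) ⟩
      r                           ∎
    where
    open ≤-Reasoning
    lv = levels G H connG connH ntG ntH centre
    lv-centre = levels-centre G H connG connH ntG ntH centre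

  open Rainbow G H connG connH ntG ntH centre r rank≤r

  -- The colouring has `2 * r + 1` colours, one fewer than the bound.
  2r+1≤2r+2 : suc (r + r) ≤ 2 * r + 2
  2r+1≤2r+2 = begin
    suc (r + r) ≡⟨ cong (λ x → suc (r + x)) (+-identityʳ r) ⟨
    suc (2 * r) ≡⟨ +-comm 1 (2 * r) ⟩
    2 * r + 1   ≤⟨ +-monoʳ-≤ (2 * r) (n≤1+n 1) ⟩
    2 * r + 2   ∎
    where open ≤-Reasoning

theorem4 :
    (G H : Graph)
    (connG : Connected G) (connH : Connected H)
    (ntG : NonTrivial G) (ntH : NonTrivial H) →
    let conn = ⊠-connected connG connH
        nt   = ⊠-nonTrivial {G} {H} ntG ntH
    in  radius (G ⊠ H) conn nt ≤ rc (G ⊠ H) conn ×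
        rc (G ⊠ H) conn ≤ 2 * radius (G ⊠ H) conn nt + 2
theorem4 G H connG connH ntG ntH =
  let conn = ⊠-connected {G} {H} connG connH
      nt   = ⊠-nonTrivial {G} {H} ntG ntH
  in  isRadius≤isRC (radius-correct (G ⊠ H) conn nt) (rc-correct (G ⊠ H) conn) ,
      isRC≤2*isRadius+2 {G} {H} connG connH ntG ntH
        (radius-correct (G ⊠ H) conn nt) (rc-correct (G ⊠ H) conn)
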